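{- Let $G$ and $H$ be connected graphs. Then $$\max\{b_{\rm g}(G),b_{\rm g}(H)\} \leq b_{\rm g}(G \boxtimes H) \leq b_{\rm g}(G \,\Box\, H) \leq \min\{2b(G^2) - 1 + \mathrm{rad}(H),\; 2 b(H^2) - 1 + \mathrm{rad}(G)\}$$ and $$\max\{b_{\rm g}'(G),b_{\rm g}'(H)\} \leq b_{\rm g}'(G \boxtimes H) \leq b_{\rm g}'(G \,\Box\, H) \leq \min\{2b(G^2) + \mathrm{rad}(H),\; 2 b(H^2) + \mathrm{rad}(G)\}.$$
   Context: All graphs are finite, simple and undirected; connected graphs are nonempty. The burning game on a graph $G$ is played by two players, Burner and Staller, in rounds $t=1,2,3,\dots$. Initially (round $0$) all vertices are unburned. Each round $t\ge 1$ consists of two phases: first, in the spreading phase, every unburned vertex having a burning neighbor starts to burn (fire spreads simultaneously, by distance one, from all burning vertices); then, in the selection phase, if unburned vertices remain, the player whose turn it is chooses one unburned vertex, which starts to burn. Burning vertices stay burning forever. The players alternate: one of them selects in the odd rounds, the other in the even rounds. The game ends in the first round in which all vertices of $G$ are burning (possibly already after the spreading phase of that round). Burner wants to minimize the number of rounds and Staller wants to maximize it. If both play optimally, the number of rounds is denoted $b_{\rm g}(G)$ when Burner makes the first move (selects in round 1), and $b_{\rm g}'(G)$ when Staller makes the first move. The burning number $b(G)$ is the minimum number of rounds needed to burn all vertices of $G$ in the same process when a single agent makes all selections (one vertex per round). The square $G^2$ of $G$ has vertex set $V(G)$, with distinct $u,v$ adjacent iff $d_G(u,v)\le 2$. The radius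 $\mathrm{rad}(G)$ is the minimum over vertices $u$ of $\max_{v\in V(G)} d_G(u,v)$. The Cartesian product $G\,\Box\, H$ has vertex set $V(G)\times V(H)$, with $(u,v)$ and $(x,y)$ adjacent iff $u=x$ and $vy\in E(H)$, or $ux\in E(G)$ and $v=y$. The strong product $G\boxtimes H$ has vertex set $V(G)\times V(H)$, with $(u,v)$ and $(x,y)$ adjacent iff $u=x$ and $vy\in E(H)$, or $ux\in E(G)$ and $v=y$, or $ux\in E(G)$ and $vy\in E(H)$. -}

module Defs where

open import Data.Bool.Base using (if_then_else_)
open import Data.List.Base using (List; []; _∷_; _++_; map; filter; length; null; cartesianProduct)
open import Data.List.Extrema.Nat using (min; max)
import Data.List.Membership.DecPropositional as DecMembership
open import Data.List.Membership.Propositional using (_∈_; find; lose)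
open import Data.List.Membership.Propositional.Properties
  using (∈-cartesianProduct⁺; ∈-filter⁺; ∈-filter⁻; ∈-++⁺ʳ)
open import Data.List.Properties using (filter-notAll; filter-reject; map-cong-local)
import Data.List.Relation.Unary.All as All
open import Data.List.Relation.Unary.Any using (any?; here; there)
open import Data.List.Relation.Unary.Enumerates.Setoid using (IsEnumeration)
open import Data.Nat.Base using (ℕ; zero; suc; _≤_; _<_; s<s; s≤s⁻¹)
open import Data.Nat.Properties using (_≤?_; ≮⇒≥; ≤-trans; <-≤-trans)
open import Data.Product.Base using (∃; _×_; _,_; proj₁; proj₂)
open import Data.Product.Properties using (≡-dec)
open import Data.Sum.Base using (_⊎_; inj₁; inj₂)
open import Function.Base using (_∘_; id)
open import Level using (0ℓ)
open import Relation.Binary.Core using (Rel)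
open import Relation.Binary.Definitions
  using (Decidable; DecidableEquality; Irreflexive; Symmetric)
open import Relation.Binary.PropositionalEquality
  using (_≡_; _≢_; refl; sym; trans; cong; cong₂; subst; setoid)
open import Relation.Nullary using (¬_; Dec; yes; no; contradiction)
open import Relation.Nullary.Decidable using (map′; ¬?; _×-dec_; _⊎-dec_)
open import Relation.Unary using (Pred) renaming (Decidable to Decidable₁)

-- `vertices` may contain repetitions; no graph invariant below depends on them.
record Graph : Set₁ where
  infix 4 _≟_ _~_ _~?_
  field
    Vertex   : Set
    vertices : List Vertex
    complete : IsEnumeration (setoid Vertex) vertices
    _≟_      : DecidableEquality Vertex
    _~_      : Rel Vertex 0ℓ
    _~?_     : Decidable _~_
    ~-sym    : Symmetric _~_
    ~-irrefl : Irreflexive _≡_ _~_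

least : {P : Pred ℕ 0ℓ} → Decidable₁ P → ∀ n → P n →
        ∃ λ k → P k × (∀ m → m < k → ¬ P m)
least P? zero    p = 0 , p , λ _ ()
least P? (suc n) p with P? 0
... | yes p₀ = 0 , p₀ , λ _ ()
... | no ¬p₀ with least (P? ∘ suc) n p
...   | k , pk , below = suc k , pk , λ where
        zero    _         → ¬p₀
        (suc m) (s<s m<k) → below m m<k

module _ (G : Graph) where
  open Graph G

  data Walk : ℕ → Vertex → Vertex → Set where
    []  : ∀ {u} → Walk 0 u u
    _∷_ : ∀ {k u w v} → u ~ w → Walk k w v → Walk (suc k) u v

  walk? : ∀ k u v → Dec (Walk k u v)
  walk? zero    u v = map′ (λ { refl → [] }) (λ { [] → refl }) (u ≟ v)
  walk? (suc k) u v =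
    map′ (λ p → let _ , _ , step = find p in proj₁ step ∷ proj₂ step)
         (λ { (e ∷ es) → lose (complete _) (e , es) })
         (any? (λ w → (u ~? w) ×-dec walk? k w v) vertices)

  snoc : ∀ {k u v w} → Walk k u v → v ~ w → Walk (suc k) u w
  snoc []       e′ = e′ ∷ []
  snoc (e ∷ es) e′ = e ∷ snoc es e′

  reverse : ∀ {k u v} → Walk k u v → Walk k v u
  reverse []       = []
  reverse (e ∷ es) = snoc (reverse es) (~-sym e)

  record Connected : Set where
    field
      base : Vertex
      walk : ∀ u v → ∃ λ k → Walk k u v

  module _ (conn : Connected) where
    open Connected conn

    geodesic : ∀ u v → ∃ λ k → Walk k u v × (∀ j → j < k → ¬ Walk j u v)
    geodesic u v = let n , w = walk u v in least (λ k → walk? k u v) n w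

    dist : Vertex → Vertex → ℕ
    dist u v = proj₁ (geodesic u v)

    dist-sym : ∀ u v → dist u v ≤ dist v u
    dist-sym u v =
      let _ , _ , below = geodesic u v
          _ , w , _     = geodesic v u
      in ≮⇒≥ λ d<d′ → below _ d<d′ (reverse w)

    eccentricity : Vertex → ℕ
    eccentricity u = max 0 (map (dist u) vertices)

    rad : ℕ
    rad = min (eccentricity base) (map eccentricity vertices)

square : (G : Graph) → Connected G → Graph
square G conn = record
  { Vertex   = Vertex
  ; vertices = vertices
  ; complete = complete
  ; _≟_      = _≟_
  ; _~_      = λ u v → u ≢ v × dist G conn u v ≤ 2
  ; _~?_     = λ u v → ¬? (u ≟ v) ×-dec (dist G conn u v ≤? 2)
  ; ~-sym    = λ {u} {v} (u≢v , d) → u≢v ∘ sym , ≤-trans (dist-sym G conn v u) d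
  ; ~-irrefl = λ u≡v (u≢v , _) → u≢v u≡v
  } where open Graph G

module _ (G H : Graph) where
  private
    module G = Graph G
    module H = Graph H

  onProduct : (_~_ : Rel (G.Vertex × H.Vertex) 0ℓ) →
              Decidable _~_ → Symmetric _~_ → Irreflexive _≡_ _~_ → Graph
  onProduct _~_ _~?_ ~-sym ~-irrefl = record
    { Vertex   = G.Vertex × H.Vertex
    ; vertices = cartesianProduct G.vertices H.vertices
    ; complete = λ (u , v) → ∈-cartesianProduct⁺ (G.complete u) (H.complete v)
    ; _≟_      = ≡-dec G._≟_ H._≟_
    ; _~_      = _~_
    ; _~?_     = _~?_
    ; ~-sym    = ~-sym
    ; ~-irrefl = ~-irrefl
    }

  infixr 7 _□_ _⊠_

  _□_ : Graph
  _□_ = onProduct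
    (λ (u , v) (x , y) → (u ≡ x × v H.~ y) ⊎ (u G.~ x × v ≡ y))
    (λ (u , v) (x , y) → ((u G.≟ x) ×-dec (v H.~? y)) ⊎-dec ((u G.~? x) ×-dec (v H.≟ y)))
    (λ { (inj₁ (e , a)) → inj₁ (sym e , H.~-sym a)
       ; (inj₂ (a , e)) → inj₂ (G.~-sym a , sym e) })
    (λ { refl (inj₁ (_ , a)) → H.~-irrefl refl a
       ; refl (inj₂ (a , _)) → G.~-irrefl refl a })

  _⊠_ : Graph
  _⊠_ = onProduct
    (λ (u , v) (x , y) → (u ≡ x × v H.~ y) ⊎ (u G.~ x × v ≡ y) ⊎ (u G.~ x × v H.~ y))
    (λ (u , v) (x , y) → ((u G.≟ x) ×-dec (v H.~? y)) ⊎-dec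
                         ((u G.~? x) ×-dec (v H.≟ y)) ⊎-dec
                         ((u G.~? x) ×-dec (v H.~? y)))
    (λ { (inj₁ (e , a))        → inj₁ (sym e , H.~-sym a)
       ; (inj₂ (inj₁ (a , e))) → inj₂ (inj₁ (G.~-sym a , sym e))
       ; (inj₂ (inj₂ (a , b))) → inj₂ (inj₂ (G.~-sym a , H.~-sym b)) })
    (λ { refl (inj₁ (_ , a))        → H.~-irrefl refl a
       ; refl (inj₂ (inj₁ (a , _))) → G.~-irrefl refl a
       ; refl (inj₂ (inj₂ (a , _))) → G.~-irrefl refl a })

data Player : Set where
  burner staller : Player

opponent : Player → Player
opponent burner  = staller
opponent staller = burner

-- The best achievable value of f over a list of options; the value for an empty
-- list is 0 because no further round is played when nothing is left to select.
optimum : {A : Set} → Player → (A → ℕ) → List A → ℕ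
optimum _       f []       = 0
optimum burner  f (x ∷ xs) = min (f x) (map f xs)
optimum staller f (x ∷ xs) = max (f x) (map f xs)

filter-filter : {A : Set} {P Q : Pred A 0ℓ} (P? : Decidable₁ P) (Q? : Decidable₁ Q) →
                (∀ {x} → P x → Q x) →
                ∀ xs → filter P? (filter Q? xs) ≡ filter P? xs
filter-filter P? Q? P⊆Q [] = refl
filter-filter P? Q? P⊆Q (x ∷ xs) with Q? x
... | no ¬q = trans (filter-filter P? Q? P⊆Q xs) (sym (filter-reject P? (¬q ∘ P⊆Q)))
... | yes _ with P? x
...   | yes _ = cong (x ∷_) (filter-filter P? Q? P⊆Q xs)
...   | no  _ = filter-filter P? Q? P⊆Q xs

-- Sets of burning vertices are represented by lists of vertices.
module _ (G : Graph) where
  open Graph G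
  open DecMembership _≟_ using (_∉?_)

  spread : List Vertex → List Vertex
  spread B = filter (λ v → any? (v ~?_) B) vertices ++ B

  unburned : List Vertex → List Vertex
  unburned B = filter (_∉? B) vertices

  -- The number of rounds still to be played under optimal play when B is burning
  -- and p is to select in the coming round; `next` says who selects after whom.
  -- The first argument truncates the process after that many rounds, which has no
  -- effect once it is at least the number of unburned vertices (`rounds-stable`).
  rounds : ℕ → (next : Player → Player) → Player → List Vertex → ℕ
  rounds zero    next p B = 0
  rounds (suc k) next p B =
    if null (unburned B) then 0
    else suc (optimum p (λ v → rounds k next (next p) (v ∷ spread B)) (unburned (spread B)))

  unburned-decreases : ∀ B v → v ∈ unburned (spread B) →
                       length (unburned (v ∷ spread B)) < length (unburned B)
  unburned-decreases B v v∈ = subst (_< _) (cong length eq)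
    (filter-notAll (_∉? (v ∷ spread B)) (unburned B) (lose v∈uB λ v∉ → v∉ (here refl)))
    where
    v∈uB : v ∈ unburned B
    v∈uB = ∈-filter⁺ (_∉? B) (complete v)
      (proj₂ (∈-filter⁻ (_∉? spread B) {xs = vertices} v∈) ∘ ∈-++⁺ʳ _)

    eq : filter (_∉? (v ∷ spread B)) (unburned B) ≡ unburned (v ∷ spread B)
    eq = filter-filter (_∉? (v ∷ spread B)) (_∉? B) (λ x∉ → x∉ ∘ there ∘ ∈-++⁺ʳ _) vertices

  optimum-cong : ∀ p {f g : Vertex → ℕ} xs → (∀ {x} → x ∈ xs → f x ≡ g x) →
                 optimum p f xs ≡ optimum p g xs
  optimum-cong _       []       _  = refl
  optimum-cong burner  (x ∷ xs) eq =
    cong₂ min (eq (here refl)) (map-cong-local (All.tabulate (eq ∘ there)))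
  optimum-cong staller (x ∷ xs) eq =
    cong₂ max (eq (here refl)) (map-cong-local (All.tabulate (eq ∘ there)))

  rounds-stable : ∀ k next p B → length (unburned B) ≤ k →
                  rounds (suc k) next p B ≡ rounds k next p B
  rounds-stable zero next p B h with unburned B
  ... | [] = refl
  rounds-stable (suc k) next p B h =
    cong (λ r → if null (unburned B) then 0 else suc r)
      (optimum-cong p (unburned (spread B)) λ {v} v∈ →
        rounds-stable k next (next p) (v ∷ spread B)
          (s≤s⁻¹ (<-≤-trans (unburned-decreases B v v∈) h)))

  play : (next : Player → Player) → Player → ℕ
  play next first = rounds (length vertices) next first []

  bg bg′ : ℕ
  bg  = play opponent burner
  bg′ = play opponent staller

  burningNumber : ℕ
  burningNumber = play id burner

{-# OPTIONS --safe #-}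

-- A retraction of graphs whose projection sends edges to edges or to single
-- vertices lets Burner copy moves along the projection while Staller's replies
-- are lifted along the section, so the retract is burned at least as fast.  This
-- gives both lower bounds and the comparison of ⊠ with □.
--
-- For the upper bounds, Burner plays an optimal burning sequence of G² inside the
-- layer over a central vertex of H.  Fire spreads twice between two of his moves,
-- which makes up for one round on G²; once the layer burns, rad H further rounds
-- suffice.

module Submission where

open import Defs
open import Data.List.Base using (List; []; _∷_; length; map)
open import Data.List.Extrema.Nat using (argmin-sel; argmax-sel; min≤v⁺; v≤max⁺; xs≤max)
open import Data.List.Membership.DecPropositional using (_∈?_; _∉?_)
open import Data.List.Membership.Propositional using (_∈_; _∉_; find; lose)
open import Data.List.Membership.Propositional.Properties
  using (∈-map⁺; ∈-map⁻; ∈-filter⁺; ∈-filter⁻; ∈-++⁺ˡ; ∈-++⁺ʳ; ∈-++⁻)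
open import Data.List.Properties using (length-filter)
open import Data.List.Relation.Binary.Subset.Propositional using (_⊆_)
import Data.List.Relation.Unary.All as All
open import Data.List.Relation.Unary.Any using (any?; here; there)
open import Data.Nat using (ℕ; zero; suc; _+_; _*_; _∸_; _⊔_; _⊓_; _≤_; z≤n; s≤s; s≤s⁻¹)
open import Data.Nat.Properties
  using (≤-refl; ≤-reflexive; ≤-trans; m≤n+m; *-suc; +-comm; ⊔-lub; ⊓-glb; <-≤-trans;
         module ≤-Reasoning)
open import Data.Product using (∃; ∃₂; _×_; _,_; proj₁; proj₂; swap)
open import Data.Sum using (_⊎_; inj₁; inj₂)
open import Function.Base using (id; _∘_)
open import Relation.Binary.PropositionalEquality
  using (_≡_; refl; sym; trans; cong; subst)
open import Relation.Nullary using (yes; no; contradiction)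
open import Relation.Nullary.Decidable using (decidable-stable)

-- Optimal values over a list of options.

module _ {A : Set} (f : A → ℕ) where

  -- The membership `x ∈ xs` rules out the empty list, whose optimum 0 is a convention and need not
  -- be a value of `f`.
  optimum-attained : ∀ p {x xs} → x ∈ xs → ∃ λ y → y ∈ xs × optimum p f xs ≡ f y
  optimum-attained burner {xs = x ∷ xs} _ with argmin-sel id (f x) (map f xs)
  ... | inj₁ eq = x , here refl , eq
  ... | inj₂ m∈ = let y , y∈ , eq = ∈-map⁻ f m∈ in y , there y∈ , eq
  optimum-attained staller {xs = x ∷ xs} _ with argmax-sel id (f x) (map f xs)
  ... | inj₁ eq = x , here refl , eq
  ... | inj₂ m∈ = let y , y∈ , eq = ∈-map⁻ f m∈ in y , there y∈ , eq

  optimum≤ : ∀ p xs {m} → (∀ {x} → x ∈ xs → f x ≤ m) → optimum p f xs ≤ m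
  optimum≤ p []          _  = z≤n
  optimum≤ p xs@(_ ∷ _) f≤m with optimum-attained p {xs = xs} (here refl)
  ... | _ , y∈ , eq = ≤-trans (≤-reflexive eq) (f≤m y∈)

  burner≤ : ∀ {x xs} → x ∈ xs → optimum burner f xs ≤ f x
  burner≤ {xs = y ∷ ys} (here refl) = min≤v⁺ (f y) (map f ys) (inj₁ ≤-refl)
  burner≤ {xs = y ∷ ys} (there x∈)  =
    min≤v⁺ (f y) (map f ys) (inj₂ (lose (∈-map⁺ f x∈) ≤-refl))

  ≤staller : ∀ {x xs} → x ∈ xs → f x ≤ optimum staller f xs
  ≤staller {xs = y ∷ ys} (here refl) = v≤max⁺ (f y) (map f ys) (inj₁ ≤-refl)
  ≤staller {xs = y ∷ ys} (there x∈)  =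
    v≤max⁺ (f y) (map f ys) (inj₂ (lose (∈-map⁺ f x∈) ≤-refl))

-- Spreading fire and the value of a position.

module _ (G : Graph) where
  open Graph G

  -- The ball of radius `r` about `B`, phrased by walks so that it applies to graphs given without a
  -- `Connected` structure, such as `G □ H`.
  Within : ℕ → List Vertex → Vertex → Set
  Within r B v = ∃₂ λ k u → k ≤ r × u ∈ B × Walk G k u v

  ⊆-spread : ∀ {B} → B ⊆ spread G B
  ⊆-spread = ∈-++⁺ʳ _

  ∈-spread⁺ : ∀ {B u v} → u ∈ B → v ~ u → v ∈ spread G B
  ∈-spread⁺ {B} {v = v} u∈B v~u =
    ∈-++⁺ˡ (∈-filter⁺ (λ v → any? (v ~?_) B) (complete v) (lose u∈B v~u))

  ∈-spread⁻ : ∀ {B v} → v ∈ spread G B → v ∈ B ⊎ ∃ λ u → u ∈ B × v ~ u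
  ∈-spread⁻ {B} v∈ with ∈-++⁻ _ v∈
  ... | inj₁ v∈f = inj₂ (find (proj₂ (∈-filter⁻ (λ v → any? (v ~?_) B) {xs = vertices} v∈f)))
  ... | inj₂ v∈B = inj₁ v∈B

  spread-mono : ∀ {B C} → B ⊆ C → spread G B ⊆ spread G C
  spread-mono B⊆C x∈ with ∈-spread⁻ x∈
  ... | inj₁ x∈B             = ⊆-spread (B⊆C x∈B)
  ... | inj₂ (u , u∈B , x~u) = ∈-spread⁺ (B⊆C u∈B) x~u

  within-zero : ∀ {B v} → Within 0 B v → v ∈ B
  within-zero (_ , _ , z≤n , u∈B , []) = u∈B

  within-suc : ∀ {r B v} → Within (suc r) B v → Within r (spread G B) v
  within-suc (_ , u , _       , u∈B , [])     = 0 , u , z≤n , ⊆-spread u∈B , []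
  within-suc (_ , _ , s≤s k≤r , u∈B , e ∷ es) = _ , _ , k≤r , ∈-spread⁺ u∈B (~-sym e) , es

  ∈-unburned⁺ : ∀ {B v} → v ∉ B → v ∈ unburned G B
  ∈-unburned⁺ {B} v∉B = ∈-filter⁺ (λ v → _∉?_ _≟_ v B) (complete _) v∉B

  ∈-unburned⁻ : ∀ {B v} → v ∈ unburned G B → v ∉ B
  ∈-unburned⁻ {B} v∈ = proj₂ (∈-filter⁻ (λ v → _∉?_ _≟_ v B) {xs = vertices} v∈)

  unburned-[] : ∀ {B} → unburned G B ≡ [] → ∀ v → v ∈ B
  unburned-[] {B} eq v = decidable-stable (_∈?_ _≟_ v B)
    λ v∉B → contradiction (subst (v ∈_) eq (∈-unburned⁺ v∉B)) λ ()

  module _ (next : Player → Player) where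

    value-after : ℕ → Player → List Vertex → Vertex → ℕ
    value-after k p B v = rounds G k next (next p) (v ∷ spread G B)

    -- With nothing unburned the value is 0, so the bound may be proved with some `v ∉ B` at hand.
    rounds≤ : ∀ k p B {m} →
              (∀ {v} → v ∉ B → suc (optimum p (value-after k p B) (unburned G (spread G B))) ≤ m) →
              rounds G (suc k) next p B ≤ m
    rounds≤ k p B h with unburned G B in eq
    ... | []    = z≤n
    ... | v ∷ _ = h (∈-unburned⁻ (subst (v ∈_) (sym eq) (here refl)))

    rounds-suc : ∀ k p B {v} → v ∉ B →
                 rounds G (suc k) next p B ≡
                 suc (optimum p (value-after k p B) (unburned G (spread G B)))
    rounds-suc k p B v∉B with unburned G B in eq
    ... | _ ∷ _ = refl
    ... | []    = contradiction (unburned-[] eq _) v∉B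

    -- Spreading alone lowers the radius by one in each round, whoever selects and whatever is
    -- selected.
    rounds-within : ∀ k {r} p B → (∀ v → Within r B v) → rounds G k next p B ≤ r
    rounds-within zero            p B near = z≤n
    rounds-within (suc k) {zero}  p B near =
      rounds≤ k p B λ v∉B → contradiction (within-zero (near _)) v∉B
    rounds-within (suc k) {suc r} p B near = rounds≤ k p B λ _ →
      s≤s (optimum≤ _ p (unburned G (spread G B)) λ _ → rounds-within k (next p) _ near′)
      where
      near′ : ∀ {w} v → Within r (w ∷ spread G B) v
      near′ v = let j , u , j≤r , u∈ , es = within-suc (near v) in j , u , j≤r , there u∈ , es

    rounds-enough : ∀ d p B {k} → length (unburned G B) ≤ k →
                    rounds G (d + k) next p B ≡ rounds G k next p B
    rounds-enough zero    p B h = refl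
    rounds-enough (suc d) p B h =
      trans (rounds-stable G _ next p B (≤-trans h (m≤n+m _ d))) (rounds-enough d p B h)

    -- Each game is truncated at the length of its own vertex list; padding gives games on two
    -- graphs a common truncation for an inductive comparison.
    play-enough : ∀ d p → rounds G (d + length vertices) next p [] ≡ play G next p
    play-enough d p = rounds-enough d p [] (length-filter _ vertices)

  -- If the desired vertex v is burning already, then any selection will do.
  burner-selects : ∀ v B (f : Vertex → ℕ) {m} → (∀ {w} → v ∈ w ∷ B → f w ≤ m) →
                   optimum burner f (unburned G B) ≤ m
  burner-selects v B f h with _∈?_ _≟_ v B
  ... | yes v∈B = optimum≤ f burner (unburned G B) λ _ → h (there v∈B)
  ... | no  v∉B = ≤-trans (burner≤ f (∈-unburned⁺ v∉B)) (h (here refl))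

-- Comparison of games along a retraction.

module Retraction
  (X Y : Graph) (f : Graph.Vertex X → Graph.Vertex Y) (s : Graph.Vertex Y → Graph.Vertex X)
  (f∘s : ∀ y → f (s y) ≡ y)
  (edge : ∀ {u v} → Graph._~_ X u v → f u ≡ f v ⊎ Graph._~_ Y (f u) (f v))
  where
  open Graph

  Covers : List (Vertex Y) → List (Vertex X) → Set
  Covers C B = ∀ {x} → x ∈ B → f x ∈ C

  covers-spread : ∀ {B C} → Covers C B → Covers (spread Y C) (spread X B)
  covers-spread cov x∈ with ∈-spread⁻ X x∈
  ... | inj₁ x∈B = ⊆-spread Y (cov x∈B)
  ... | inj₂ (u , u∈B , x~u) with edge x~u
  ...   | inj₁ fx≡fu = ⊆-spread Y (subst (_∈ _) (sym fx≡fu) (cov u∈B))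
  ...   | inj₂ fx~fu = ∈-spread⁺ Y (cov u∈B) fx~fu

  lift-∉ : ∀ {B C y} → Covers C B → y ∉ C → s y ∉ B
  lift-∉ cov y∉C sy∈B = y∉C (subst (_∈ _) (f∘s _) (cov sy∈B))

  -- Either `v` is `f u`, or `f u` burns in `C` already and `v` is arbitrary; so Burner can follow a
  -- move even when its image is taken.
  covers-∷ : ∀ {B C u v} → f u ∈ v ∷ C → Covers C B → Covers (v ∷ C) (u ∷ B)
  covers-∷ fu∈ cov (here refl) = fu∈
  covers-∷ fu∈ cov (there x∈)  = there (cov x∈)

  -- Mutual induction with `optimum-mono`: `Covers` survives a spreading phase and a pair of
  -- corresponding moves, so the fire on `Y` never falls behind.
  rounds-mono : ∀ k next p {B C} → Covers C B → rounds Y k next p C ≤ rounds X k next p B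
  optimum-mono : ∀ k next p {B C} → Covers C B →
                 optimum p (value-after Y next k p C) (unburned Y (spread Y C)) ≤
                 optimum p (value-after X next k p B) (unburned X (spread X B))

  rounds-mono zero    next p cov = z≤n
  rounds-mono (suc k) next p {B} {C} cov = rounds≤ Y next k p C λ y∉C →
    ≤-trans (s≤s (optimum-mono k next p cov))
            -- An unburned `y` lifts to the unburned `s y`, so the game on `X` plays this round too.
            (≤-reflexive (sym (rounds-suc X next k p B (lift-∉ cov y∉C))))

  optimum-mono k next burner {B} {C} cov with unburned Y (spread Y C) in eq
  ... | [] = z≤n
  -- Since `s y` is unburned, Burner has an optimal move `x` on `X`; he aims at `f x` on `Y`.
  ... | y ∷ ys with optimum-attained (value-after X next k burner B) burner
                      (∈-unburned⁺ X (lift-∉ (covers-spread cov)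
                        (∈-unburned⁻ Y (subst (y ∈_) (sym eq) (here refl)))))
  ...   | x , _ , attained = begin
    optimum burner (value-after Y next k burner C) (y ∷ ys)
      ≡⟨ cong (optimum burner _) eq ⟨
    optimum burner (value-after Y next k burner C) (unburned Y (spread Y C))
      ≤⟨ burner-selects Y (f x) (spread Y C) _ (λ fx∈ →
           rounds-mono k next (next burner) (covers-∷ fx∈ (covers-spread cov))) ⟩
    value-after X next k burner B x
      ≡⟨ attained ⟨
    optimum burner (value-after X next k burner B) (unburned X (spread X B)) ∎
    where open ≤-Reasoning
  -- Each option `y` of Staller on `Y` has its lift `s y` among the options on `X`, and
  -- `f (s y) ≡ y` preserves `Covers`.
  optimum-mono k next staller cov = optimum≤ _ staller _ λ {y} y∈ →
    ≤-trans (rounds-mono k next (next staller)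
              (covers-∷ (here (f∘s y)) (covers-spread cov)))
            (≤staller _ (∈-unburned⁺ X (lift-∉ (covers-spread cov) (∈-unburned⁻ Y y∈))))

  play-mono : ∀ next p → play Y next p ≤ play X next p
  play-mono next p = begin
    play Y next p                 ≡⟨ play-enough Y next m p ⟨
    rounds Y (m + n) next p []    ≤⟨ rounds-mono (m + n) next p (λ ()) ⟩
    rounds X (m + n) next p []    ≡⟨ cong (λ k → rounds X k next p []) (+-comm m n) ⟩
    rounds X (n + m) next p []    ≡⟨ play-enough X next n p ⟩
    play X next p                 ∎
    where
    open ≤-Reasoning
    m = length (vertices X)
    n = length (vertices Y)

-- Burning sequences and their imitation on another graph.

module _ (G : Graph) where
  open Graph G

  -- The chosen `v` may be burning already, so a sequence can have one entry per round even when the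
  -- last round ends by spreading alone.
  Burnable : ℕ → List Vertex → Set
  Burnable zero    B = ∀ v → v ∈ B
  Burnable (suc n) B = ∃ λ v → Burnable n (v ∷ spread G B)

  -- Under `id` Burner makes every selection, so following attained minima yields a burning
  -- sequence; `h` ensures that nothing is unburned when the truncation takes effect.
  burnable-rounds : ∀ k B → length (unburned G B) ≤ k → Burnable (rounds G k id burner B) B
  burnable-rounds zero B h with unburned G B in eq
  ... | [] = unburned-[] G eq
  burnable-rounds (suc k) B h with unburned G B in eq
  ... | []    = unburned-[] G eq
  ... | v ∷ _ with unburned G (spread G B) in eq′
  -- Spreading leaves nothing to select, yet the round counts; `v` is a dummy entry.
  ...   | []     = v , λ u → there (unburned-[] G eq′ u)
  ...   | w ∷ ws with optimum-attained (value-after G id k burner B) burner {xs = w ∷ ws} (here refl)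
  ...     | x , x∈ , attained = x ,
    subst (λ n → Burnable n (x ∷ spread G B)) (sym attained)
      (burnable-rounds k _ (s≤s⁻¹ (<-≤-trans
        (unburned-decreases G B x (subst (x ∈_) (sym eq′) x∈))
        (≤-trans (≤-reflexive (cong length eq)) h))))

  burnable : Burnable (burningNumber G) []
  burnable = burnable-rounds _ [] (length-filter _ vertices)

-- Burner imitates on K, through ι, a burning sequence of S.
module Imitation
  (S K : Graph) (ι : Graph.Vertex S → Graph.Vertex K) (r : ℕ)
  (edge : ∀ {u v} → Graph._~_ S u v → ∃ λ k → k ≤ 2 × Walk K k (ι u) (ι v))
  (near : ∀ x → ∃₂ λ u k → k ≤ r × Walk K k (ι u) x)
  where
  open Graph

  Covers : List (Vertex K) → List (Vertex S) → Set
  Covers C B = ∀ {u} → u ∈ B → ι u ∈ C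

  covers-spread : ∀ {B C} → Covers C B → Covers (spread K (spread K C)) (spread S B)
  covers-spread cov u∈ with ∈-spread⁻ S u∈
  ... | inj₁ u∈B = ⊆-spread K (⊆-spread K (cov u∈B))
  ... | inj₂ (v , v∈B , u~v) =
    let k , k≤2 , es = edge (~-sym S u~v)
    in within-zero K (within-suc K (within-suc K (k , ι v , k≤2 , cov v∈B , es)))

  -- Of the two spreads on `K` that match one on `S`, the second is still to come on Burner's turn,
  -- so the fires are compared after the coming spread. The bound counts this round, two rounds for
  -- each of the `n` later selections, and `r` rounds to spread from the image of `ι`.
  burner-turn : ∀ k n {B C} → Covers (spread K C) (spread S B) → Burnable S (suc n) B →
                rounds K k opponent burner C ≤ suc (2 * n + r)
  staller-turn : ∀ k n {B C} → Covers C B → Burnable S n B →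
                 rounds K k opponent staller C ≤ 2 * n + r

  burner-turn zero    n cov burn = z≤n
  burner-turn (suc k) n {C = C} cov (v , burn) = rounds≤ K opponent k burner C λ _ → s≤s
    (burner-selects K (ι v) (spread K C) _ λ ιv∈ →
      staller-turn k n (λ { (here refl) → ιv∈ ; (there u∈) → there (cov u∈) }) burn)

  staller-turn zero    n       cov burn = z≤n
  staller-turn (suc k) zero    cov burn = rounds-within K opponent (suc k) staller _ λ x →
    let u , j , j≤r , es = near x in j , ι u , j≤r , cov (burn u) , es
  staller-turn (suc k) (suc n) {C = C} cov burn = ≤-trans
    (rounds≤ K opponent k staller C λ _ → s≤s (optimum≤ _ staller (unburned K (spread K C)) λ _ →
      -- Staller's selection only enlarges the fire on `K`.
      burner-turn k n (spread-mono K there ∘ covers-spread cov) burn))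
    (≤-reflexive (cong (_+ r) (sym (*-suc 2 n))))

  -- Burner's opening move has no round of Staller before it, which saves one round against `bg′≤`.
  bg≤ : Vertex S → bg K ≤ 2 * burningNumber S ∸ 1 + r
  bg≤ u with burningNumber S | burnable S
  -- The empty fire misses `u`, so the burning number is positive and `∸ 1` is a true subtraction.
  ... | zero  | burn = contradiction (burn u) λ ()
  ... | suc n | burn = ≤-trans
    (burner-turn (length (vertices K)) n covers-spread-[] burn)
    (≤-reflexive (cong (λ m → m ∸ 1 + r) (sym (*-suc 2 n))))
    where
    covers-spread-[] : ∀ {C} → Covers C (spread S [])
    covers-spread-[] u∈ with ∈-spread⁻ S u∈
    ... | inj₂ (_ , () , _)

  bg′≤ : bg′ K ≤ 2 * burningNumber S + r
  bg′≤ = staller-turn (length (vertices K)) (burningNumber S) (λ ()) (burnable S)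

-- Central vertices and layers of products.

module _ (H : Graph) (c : Connected H) where
  open Graph H

  centre : ∃ λ h → ∀ v → dist H c h v ≤ rad H c
  centre =
    -- `rad` unfolds to Burner's optimum of the eccentricities over `base ∷ vertices`, so it is
    -- attained at some vertex.
    let h , _ , rad≡ = optimum-attained (eccentricity H c) burner
                         {xs = Connected.base c ∷ vertices} (here refl)
    in h , λ v → ≤-trans
         (All.lookup (xs≤max 0 (map (dist H c h) vertices)) (∈-map⁺ (dist H c h) (complete v)))
         (≤-reflexive (sym rad≡))

module _ (G H : Graph) where
  private
    module G = Graph G
    module H = Graph H

  walk-□ˡ : ∀ {k u v} h → Walk G k u v → Walk (G □ H) k (u , h) (v , h)
  walk-□ˡ h []       = []
  walk-□ˡ h (e ∷ es) = inj₂ (e , refl) ∷ walk-□ˡ h es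

  walk-□ʳ : ∀ {k x y} u → Walk H k x y → Walk (G □ H) k (u , x) (u , y)
  walk-□ʳ u []       = []
  walk-□ʳ u (e ∷ es) = inj₁ (refl , e) ∷ walk-□ʳ u es

  -- An isomorphism is a retraction. Exchanging the factors carries the first term of each minimum
  -- to the second.
  play-□-swap : ∀ next p → play (G □ H) next p ≤ play (H □ G) next p
  play-□-swap = Retraction.play-mono (H □ G) (G □ H) swap swap (λ _ → refl)
    λ { (inj₁ (e , a)) → inj₂ (inj₂ (a , e)) ; (inj₂ (a , e)) → inj₂ (inj₁ (e , a)) }

  -- `G □ H` is a spanning subgraph of `G ⊠ H`, so the identity serves as both projection and
  -- section.
  play-⊠≤play-□ : ∀ next p → play (G ⊠ H) next p ≤ play (G □ H) next p
  play-⊠≤play-□ = Retraction.play-mono (G □ H) (G ⊠ H) id id (λ _ → refl)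
    λ { (inj₁ a) → inj₂ (inj₁ a) ; (inj₂ a) → inj₂ (inj₂ (inj₁ a)) }

  -- Even a diagonal edge of `⊠` projects to an edge of `G`; `h` fixes the layer into which
  -- Staller's replies are lifted.
  playˡ≤play-⊠ : H.Vertex → ∀ next p → play G next p ≤ play (G ⊠ H) next p
  playˡ≤play-⊠ h = Retraction.play-mono (G ⊠ H) G proj₁ (_, h) (λ _ → refl)
    λ { (inj₁ (e , _)) → inj₁ e
      ; (inj₂ (inj₁ (a , _))) → inj₂ a
      ; (inj₂ (inj₂ (a , _))) → inj₂ a }

  playʳ≤play-⊠ : G.Vertex → ∀ next p → play H next p ≤ play (G ⊠ H) next p
  playʳ≤play-⊠ g = Retraction.play-mono (G ⊠ H) H proj₂ (g ,_) (λ _ → refl)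
    λ { (inj₁ (_ , a)) → inj₂ a
      ; (inj₂ (inj₁ (_ , e))) → inj₁ e
      ; (inj₂ (inj₂ (_ , a))) → inj₂ a }

  module _ (cG : Connected G) (cH : Connected H) where
    square-edge-□ : ∀ h {u v} → Graph._~_ (square G cG) u v →
                    ∃ λ k → k ≤ 2 × Walk (G □ H) k (u , h) (v , h)
    square-edge-□ h {u} {v} (_ , d≤2) =
      let k , es , _ = geodesic G cG u v in k , d≤2 , walk-□ˡ h es

    central-layer-near : ∀ x → ∃₂ λ u k →
                         k ≤ rad H cH × Walk (G □ H) k (u , proj₁ (centre H cH)) x
    central-layer-near (u , y) =
      let h , ≤rad = centre H cH
          k , es , _ = geodesic H cH h y
      in u , k , ≤rad y , walk-□ʳ u es

    bg-□≤ : bg (G □ H) ≤ 2 * burningNumber (square G cG) ∸ 1 + rad H cH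
    bg-□≤ = Imitation.bg≤ (square G cG) (G □ H) (_, proj₁ (centre H cH)) (rad H cH)
      (square-edge-□ _) central-layer-near (Connected.base cG)

    bg′-□≤ : bg′ (G □ H) ≤ 2 * burningNumber (square G cG) + rad H cH
    bg′-□≤ = Imitation.bg′≤ (square G cG) (G □ H) (_, proj₁ (centre H cH)) (rad H cH)
      (square-edge-□ _) central-layer-near

proposition17 : (G H : Graph) (cG : Connected G) (cH : Connected H) →
    ( bg G ⊔ bg H ≤ bg (G ⊠ H)
    × bg (G ⊠ H) ≤ bg (G □ H)
    × bg (G □ H) ≤ (2 * burningNumber (square G cG) ∸ 1 + rad H cH)
    ⊓ (2 * burningNumber (square H cH) ∸ 1 + rad G cG) )
    ×
    ( bg′ G ⊔ bg′ H ≤ bg′ (G ⊠ H)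
    × bg′ (G ⊠ H) ≤ bg′ (G □ H)
    × bg′ (G □ H) ≤ (2 * burningNumber (square G cG) + rad H cH)
    ⊓ (2 * burningNumber (square H cH) + rad G cG) )
proposition17 G H cG cH =
  ( lower burner
  , play-⊠≤play-□ G H opponent burner
  , ⊓-glb (bg-□≤ G H cG cH) (≤-trans (play-□-swap G H opponent burner) (bg-□≤ H G cH cG)) ) ,
  ( lower staller
  , play-⊠≤play-□ G H opponent staller
  , ⊓-glb (bg′-□≤ G H cG cH) (≤-trans (play-□-swap G H opponent staller) (bg′-□≤ H G cH cG)) )
  where
  lower : ∀ p → play G opponent p ⊔ play H opponent p ≤ play (G ⊠ H) opponent p
  lower p = ⊔-lub (playˡ≤play-⊠ G H (Connected.base cH) opponent p)
                  (playʳ≤play-⊠ G H (Connected.base cG) opponent p)
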